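{- Let $G$ be a connected finite simple graph on $n$ vertices, let $1\le k\le n-1$ be an integer, let $S=\{x,y\}$ be a 2-cut with the same neighbours of $G$, and let $\alpha\subseteq T_S$. Then the map $\varphi_{S,\alpha}$ is an automorphism of $F_k(G)$. Moreover, $\varphi_{S,\alpha}$ is an induced automorphism of $F_k(G)$ if and only if $\alpha=\emptyset$ or $\alpha=T_S$.
   Context: The $k$-token graph $F_k(G)$ is the graph whose vertices are all $k$-subsets of $V(G)$, where $A$ and $B$ are adjacent whenever their symmetric difference $A\triangle B$ is an edge of $G$ (i.e. a pair of adjacent vertices of $G$). For $f\in\operatorname{Aut}(G)$, let $\iota(f)\in\operatorname{Aut}(F_k(G))$ be given by $\iota(f)(\{a_1,\dots,a_k\})=\{f(a_1),\dots,f(a_k)\}$. When $k=n/2$, the complement automorphism $\mathfrak{c}\in \operatorname{Aut}(F_k(G))$ is given by $\mathfrak{c}(A)=V(G)\setminus A$. An automorphism $g$ of $F_k(G)$ is called induced if there exists $f\in\operatorname{Aut}(G)$ such that $g=\iota(f)$ or (when $k=n/2$) $g=\mathfrak{c}\circ\iota(f)$. A 2-cut with the same neighbours of $G$ is a set $S=\{x,y\}$ of two distinct vertices of $G$ such that $S$ is a cut set of $G$ (that is, $G\setminus S$ is disconnected) and $x$ and $y$ have the same neighbours in $V(G)\setminus S$. Let $G_1,\dots,G_{c_S}$ be the connected components of $G\setminus S$ in some fixed order, and let $n_i=|V(G_i)|$. Define \[T_S:=\Big\{(k_1,\dots,k_{c_S}) : k_i\in\mathbb{Z},\ 0\le k_i\le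 n_i \text{ for every } i,\ \sum_{i=1}^{c_S}k_i=k-1\Big\}.\] For $t\in T_S$, with $i$-th coordinate $t(i)$, let \[V_{S,t}:=\{A\in V(F_k(G)) : |A\cap V(G_i)|=t(i)\text{ for every }1\le i\le c_S\};\] thus every $A\in V_{S,t}$ satisfies $|A\cap S|=1$. For $A$ with $|A\cap S|=1$ let $A^S:=(A\setminus S)\cup(S\setminus A)$. For $\alpha\subseteq T_S$, the map $\varphi_{S,\alpha}:V(F_k(G))\to V(F_k(G))$ is defined by $\varphi_{S,\alpha}(A):=A^S$ if there exists $t\in\alpha$ such that $A\in V_{S,t}$, and $\varphi_{S,\alpha}(A):=A$ otherwise. -}

module Defs where

open import Level using (0ℓ)
open import Data.Bool.Base using (true; false)
open import Data.Fin.Base using (Fin; zero; suc)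
open import Data.Fin.Properties using (suc-injective; ¬Fin0)
open import Data.Fin.Subset
  using (Subset; inside; outside; ⊥; ⁅_⁆; _∈_; _∉_; _∩_; _∪_; _─_; ∁; ∣_∣; Empty; _⊆_)
open import Data.Fin.Subset.Properties
open import Data.Nat.Base using (ℕ; zero; suc; _+_; _*_; _∸_; _≤_)
open import Data.Nat.Properties
  using (+-suc; +-identityʳ; +-cancelʳ-≡; m+n∸n≡m)
open import Data.Product using (∃; ∃₂; Σ-syntax; ∃-syntax; _×_; _,_; proj₁; proj₂)
open import Data.Sum using (_⊎_; inj₁; inj₂)
open import Data.Vec.Base using (Vec; []; _∷_; here; there; lookup; tabulate; sum)
open import Data.Vec.Properties using (tabulate-cong; tabulate∘lookup; lookup∘tabulate)
open import Function.Base using (_∘_)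
open import Function.Bundles using (_⇔_; Equivalence)
open import Function.Definitions using (Injective; Bijective)
open import Relation.Binary.Core using (Rel)
open import Relation.Binary.Construct.Closure.ReflexiveTransitive using (Star)
open import Relation.Binary.Definitions using (Irreflexive; Symmetric)
open import Relation.Binary.PropositionalEquality
  using (_≡_; _≢_; refl; sym; trans; cong; cong₂; subst; module ≡-Reasoning)
open import Relation.Nullary using (¬_; Dec; yes; no; contradiction)
open import Relation.Unary using (Pred; Decidable; Satisfiable)
import Relation.Unary as U

private
  variable
    m n : ℕ

------------------------------------------------------------------------
-- Graphs

record Graph (V : Set) : Set₁ where
  field
    _~_    : Rel V 0ℓ
    sym-~  : Symmetric _~_
    irrefl : Irreflexive _≡_ _~_

module _ {V : Set} (G : Graph V) where
  open Graph G

  Reachable : Rel V 0ℓ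
  Reachable = Star _~_

  Connected : Set
  Connected = ∀ u v → Reachable u v

  IsComponent : Pred V 0ℓ → Set
  IsComponent C = Satisfiable C × (∀ {u v} → C u → (C v ⇔ Reachable u v))

  record IsAutomorphism (f : V → V) : Set where
    field
      bijective : Bijective _≡_ _≡_ f
      adjacency : ∀ {u v} → u ~ v ⇔ f u ~ f v

  record Automorphism : Set where
    constructor mkAut
    field
      to             : V → V
      isAutomorphism : IsAutomorphism to

    injective : Injective _≡_ _≡_ to
    injective = proj₁ (IsAutomorphism.bijective isAutomorphism)

-- Two vertices of the induced subgraph are equal as soon as their first
-- components are: proofs of _∉_ are definitionally irrelevant.
infixl 5 _∖_
_∖_ : Graph (Fin n) → (S : Subset n) → Graph (∃ (_∉ S))
G ∖ S = record
  { _~_    = λ u v → proj₁ u ~ proj₁ v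
  ; sym-~  = sym-~
  ; irrefl = λ { refl → irrefl refl }
  }
  where open Graph G

------------------------------------------------------------------------
-- Cardinalities of finite sets

infixl 5 _△_
_△_ : Subset n → Subset n → Subset n
A △ B = (A ─ B) ∪ (B ─ A)

△-comm : (A B : Subset n) → A △ B ≡ B △ A
△-comm A B = ∪-comm (A ─ B) (B ─ A)

△-self : (A : Subset n) → A △ A ≡ ⊥
△-self []          = refl
△-self (true  ∷ A) = cong (false ∷_) (△-self A)
△-self (false ∷ A) = cong (false ∷_) (△-self A)

∣△∣ : (p q : Subset n) → ∣ p △ q ∣ + (∣ p ∩ q ∣ + ∣ p ∩ q ∣) ≡ ∣ p ∣ + ∣ q ∣
∣△∣ []          []          = refl
∣△∣ (true  ∷ p) (true  ∷ q) =
  step (∣ p △ q ∣) (∣ p ∩ q ∣) (∣ p ∣) (∣ q ∣) (∣△∣ p q)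
  where
  step : ∀ d i a b → d + (i + i) ≡ a + b → d + (suc i + suc i) ≡ suc a + suc b
  step d i a b eq rewrite +-suc i i | +-suc d (suc (i + i)) | +-suc d (i + i) | +-suc a b =
    cong (2 +_) eq
∣△∣ (true  ∷ p) (false ∷ q) = cong suc (∣△∣ p q)
∣△∣ (false ∷ p) (true  ∷ q) rewrite +-suc ∣ p ∣ ∣ q ∣ = cong suc (∣△∣ p q)
∣△∣ (false ∷ p) (false ∷ q) = ∣△∣ p q

∣∪∣ : (p q : Subset n) → ∣ p ∪ q ∣ + ∣ p ∩ q ∣ ≡ ∣ p ∣ + ∣ q ∣
∣∪∣ []          []          = refl
∣∪∣ (true  ∷ p) (true  ∷ q)
  rewrite +-suc ∣ p ∪ q ∣ ∣ p ∩ q ∣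
        | +-suc ∣ p ∣ ∣ q ∣ = cong (2 +_) (∣∪∣ p q)
∣∪∣ (true  ∷ p) (false ∷ q) = cong suc (∣∪∣ p q)
∣∪∣ (false ∷ p) (true  ∷ q) rewrite +-suc ∣ p ∣ ∣ q ∣ = cong suc (∣∪∣ p q)
∣∪∣ (false ∷ p) (false ∷ q) = ∣∪∣ p q

∣∩∣+∣─∣ : (p q : Subset n) → ∣ p ∩ q ∣ + ∣ p ─ q ∣ ≡ ∣ p ∣
∣∩∣+∣─∣ []          []          = refl
∣∩∣+∣─∣ (true  ∷ p) (true  ∷ q) = cong suc (∣∩∣+∣─∣ p q)
∣∩∣+∣─∣ (true  ∷ p) (false ∷ q) =
  trans (+-suc ∣ p ∩ q ∣ ∣ p ─ q ∣) (cong suc (∣∩∣+∣─∣ p q))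
∣∩∣+∣─∣ (false ∷ p) (true  ∷ q) = ∣∩∣+∣─∣ p q
∣∩∣+∣─∣ (false ∷ p) (false ∷ q) = ∣∩∣+∣─∣ p q

∣empty∣ : {p : Subset n} → Empty p → ∣ p ∣ ≡ 0
∣empty∣ {n} ep = trans (cong ∣_∣ (Empty-unique ep)) (∣⊥∣≡0 n)

x∈p─q⇒x∉q : ∀ {x} {p q : Subset n} → x ∈ p ─ q → x ∉ q
x∈p─q⇒x∉q {p = _ ∷ _} {_ ∷ _} (there x∈p─q) (there x∈q) = x∈p─q⇒x∉q x∈p─q x∈q
x∈p─q⇒x∉q {p = _ ∷ _} {true ∷ _} () here

∣insert∣ : ∀ {x} {p : Subset n} → x ∉ p → ∣ ⁅ x ⁆ ∪ p ∣ ≡ suc ∣ p ∣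
∣insert∣ {x = x} {p} x∉p = begin
  ∣ ⁅ x ⁆ ∪ p ∣                 ≡⟨ +-identityʳ _ ⟨
  ∣ ⁅ x ⁆ ∪ p ∣ + 0             ≡⟨ cong (∣ ⁅ x ⁆ ∪ p ∣ +_) (∣empty∣ disjoint) ⟨
  ∣ ⁅ x ⁆ ∪ p ∣ + ∣ ⁅ x ⁆ ∩ p ∣ ≡⟨ ∣∪∣ ⁅ x ⁆ p ⟩
  ∣ ⁅ x ⁆ ∣ + ∣ p ∣             ≡⟨ cong (_+ ∣ p ∣) (∣⁅x⁆∣≡1 x) ⟩
  suc ∣ p ∣                     ∎
  where
  open ≡-Reasoning
  disjoint : Empty (⁅ x ⁆ ∩ p)
  disjoint (z , z∈) with x∈p∩q⁻ ⁅ x ⁆ p z∈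
  ... | z∈x , z∈p = x∉p (subst (_∈ p) (x∈⁅y⁆⇒x≡y x z∈x) z∈p)

∣pair∣ : {x y : Fin n} → x ≢ y → ∣ ⁅ x ⁆ ∪ ⁅ y ⁆ ∣ ≡ 2
∣pair∣ {y = y} x≢y = trans (∣insert∣ (x≢y⇒x∉⁅y⁆ x≢y)) (cong suc (∣⁅x⁆∣≡1 y))

∣partition∣ : (P : Fin m → Subset n) (B : Subset n) →
              (∀ i {v} → v ∈ P i → v ∈ B) →
              (∀ {v} → v ∈ B → ∃[ i ] v ∈ P i) →
              (∀ {i j v} → v ∈ P i → v ∈ P j → i ≡ j) →
              sum (tabulate (∣_∣ ∘ P)) ≡ ∣ B ∣
∣partition∣ {zero}  P B sub cov dis = sym (∣empty∣ λ (_ , v∈B) → ¬Fin0 (proj₁ (cov v∈B)))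
∣partition∣ {suc m} P B sub cov dis = begin
  ∣ P zero ∣ + sum (tabulate (∣_∣ ∘ P ∘ suc)) ≡⟨ cong₂ _+_ (cong ∣_∣ P₀≡) rest ⟩
  ∣ B ∩ P zero ∣ + ∣ B ─ P zero ∣             ≡⟨ ∣∩∣+∣─∣ B (P zero) ⟩
  ∣ B ∣                                       ∎
  where
  open ≡-Reasoning
  P₀≡ : P zero ≡ B ∩ P zero
  P₀≡ = ⊆-antisym (λ v∈ → x∈p∩q⁺ (sub zero v∈ , v∈)) (p∩q⊆q B (P zero))
  cov′ : ∀ {v} → v ∈ B ─ P zero → ∃[ i ] v ∈ P (suc i)
  cov′ v∈ with cov (p─q⊆p B (P zero) v∈)
  ... | zero  , v∈P₀ = contradiction v∈P₀ (x∈p─q⇒x∉q {p = B} v∈)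
  ... | suc i , v∈Pi = i , v∈Pi
  zero≢suc : ∀ {i : Fin m} → zero ≢ suc i
  zero≢suc ()
  rest : sum (tabulate (∣_∣ ∘ P ∘ suc)) ≡ ∣ B ─ P zero ∣
  rest = ∣partition∣ (P ∘ suc) (B ─ P zero)
    (λ i v∈ → x∈p∧x∉q⇒x∈p─q (sub (suc i) v∈) (λ v∈P₀ → zero≢suc (dis v∈P₀ v∈)))
    cov′
    (λ v∈ v∈′ → suc-injective (dis v∈ v∈′))

-- { f a : a ∈ A }
image : (Fin m → Fin n) → Subset m → Subset n
image f []            = ⊥
image f (outside ∷ A) = image (f ∘ suc) A
image f (inside  ∷ A) = ⁅ f zero ⁆ ∪ image (f ∘ suc) A

∈-image⁻ : (f : Fin m → Fin n) (A : Subset m) → ∀ {v} →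
           v ∈ image f A → ∃[ a ] a ∈ A × f a ≡ v
∈-image⁻ f []            v∈ = contradiction v∈ ∉⊥
∈-image⁻ f (outside ∷ A) v∈ with ∈-image⁻ (f ∘ suc) A v∈
... | a , a∈A , eq = suc a , there a∈A , eq
∈-image⁻ f (inside  ∷ A) v∈ with x∈p∪q⁻ ⁅ f zero ⁆ _ v∈
... | inj₁ v∈f0 = zero , here , sym (x∈⁅y⁆⇒x≡y _ v∈f0)
... | inj₂ v∈′ with ∈-image⁻ (f ∘ suc) A v∈′
...   | a , a∈A , eq = suc a , there a∈A , eq

∈-image⁺ : (f : Fin m → Fin n) (A : Subset m) → ∀ {a} → a ∈ A → f a ∈ image f A
∈-image⁺ f (inside  ∷ A) here        = x∈p∪q⁺ (inj₁ (x∈⁅x⁆ (f zero)))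
∈-image⁺ f (inside  ∷ A) (there a∈A) = x∈p∪q⁺ (inj₂ (∈-image⁺ (f ∘ suc) A a∈A))
∈-image⁺ f (outside ∷ A) (there a∈A) = ∈-image⁺ (f ∘ suc) A a∈A

∣image∣ : (f : Fin m → Fin n) → Injective _≡_ _≡_ f → (A : Subset m) →
          ∣ image f A ∣ ≡ ∣ A ∣
∣image∣ {n = n} f inj []  = ∣⊥∣≡0 n
∣image∣ f inj (outside ∷ A) = ∣image∣ (f ∘ suc) (suc-injective ∘ inj) A
∣image∣ f inj (inside  ∷ A) =
  trans (∣insert∣ f0∉) (cong suc (∣image∣ (f ∘ suc) (suc-injective ∘ inj) A))
  where
  f0∉ : f zero ∉ image (f ∘ suc) A
  f0∉ f0∈ with ∈-image⁻ (f ∘ suc) A f0∈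
  ... | a , _ , eq with inj eq
  ...   | ()

------------------------------------------------------------------------
-- Token graphs

-- Equality of the cardinality proofs is no obstacle, as ℕ is a set.
KSubset : ℕ → ℕ → Set
KSubset n k = Σ[ A ∈ Subset n ] ∣ A ∣ ≡ k

tokenGraph : (k : ℕ) → Graph (Fin n) → Graph (KSubset n k)
tokenGraph k G = record
  { _~_    = λ A B → ∃₂ λ u v → u ~ v × proj₁ A △ proj₁ B ≡ ⁅ u ⁆ ∪ ⁅ v ⁆
  ; sym-~  = λ { {A , _} {B , _} (u , v , u~v , eq) → u , v , u~v , trans (△-comm B A) eq }
  ; irrefl = λ { {A , _} refl (u , v , _ , eq) →
      ∉⊥ (subst (u ∈_) (trans (sym eq) (△-self A)) (x∈p∪q⁺ (inj₁ (x∈⁅x⁆ u)))) }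
  }
  where open Graph G

ι : ∀ {k} {G : Graph (Fin n)} → Automorphism G → KSubset n k → KSubset n k
ι f (A , ∣A∣≡k) = image to A , trans (∣image∣ to injective A) ∣A∣≡k
  where open Automorphism f

𝔠 : ∀ {k} → n ≡ 2 * k → KSubset n k → KSubset n k
𝔠 {n} {k} n≡2k (A , ∣A∣≡k) = ∁ A , (begin
  ∣ ∁ A ∣         ≡⟨ ∣∁p∣≡n∸∣p∣ A ⟩
  n ∸ ∣ A ∣       ≡⟨ cong₂ _∸_ n≡2k ∣A∣≡k ⟩
  k + (k + 0) ∸ k ≡⟨ cong (λ j → k + j ∸ k) (+-identityʳ k) ⟩
  k + k ∸ k       ≡⟨ m+n∸n≡m k k ⟩
  k               ∎)
  where open ≡-Reasoning

Induced : (k : ℕ) (G : Graph (Fin n)) → Automorphism (tokenGraph k G) → Set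
Induced {n} k G g = Σ[ f ∈ Automorphism G ]
  ( (∀ A → to g A ≡ ι f A)
  ⊎ (Σ[ n≡2k ∈ n ≡ 2 * k ] (∀ A → to g A ≡ 𝔠 n≡2k (ι f A))) )
  where open Automorphism using (to)

------------------------------------------------------------------------
-- 2-cuts with the same neighbours

record TwinCut (G : Graph (Fin n)) : Set where
  open Graph G
  field
    x y : Fin n
    x≢y : x ≢ y

  S : Subset n
  S = ⁅ x ⁆ ∪ ⁅ y ⁆

  field
    cut             : ¬ Connected (G ∖ S)
    same-neighbours : ∀ v → v ∉ S → x ~ v ⇔ y ~ v

-- An enumeration, without repetition, of the vertex sets of the
-- connected components of G ∖ S.
record Components (G : Graph (Fin n)) (S : Subset n) : Set where
  field
    c           : ℕ
    V           : Fin c → Subset n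
    avoids      : ∀ i {v} → v ∈ V i → v ∉ S
    isComponent : ∀ i → IsComponent (G ∖ S) (λ v → proj₁ v ∈ V i)
    injective   : Injective _≡_ _≡_ V
    covers      : ∀ v → v ∉ S → ∃[ i ] v ∈ V i

  disjoint : ∀ {i j v} → v ∈ V i → v ∈ V j → i ≡ j
  disjoint {i} {j} v∈i v∈j = injective (⊆-antisym (sub v∈i v∈j) (sub v∈j v∈i))
    where
    sub : ∀ {i j v} → v ∈ V i → v ∈ V j → V i ⊆ V j
    sub {i} {j} v∈i v∈j w∈i =
      Equivalence.from (proj₂ (isComponent j) {_ , avoids j v∈j} {_ , avoids i w∈i} v∈j)
        (Equivalence.to (proj₂ (isComponent i)
           {_ , avoids i v∈i} {_ , avoids i w∈i} v∈i) w∈i)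

module _ {G : Graph (Fin n)} (k : ℕ) (cut : TwinCut G)
         (comps : Components G (TwinCut.S cut)) where
  open TwinCut cut
  open Components comps

  -- The last condition is sum t = k − 1 in ℤ; truncated subtraction is
  -- avoided.
  T : Pred (Vec ℕ c) 0ℓ
  T t = (∀ i → lookup t i ≤ ∣ V i ∣) × suc (sum t) ≡ k

  Layer : Vec ℕ c → Pred (KSubset n k) 0ℓ
  Layer t (A , _) = ∀ i → ∣ A ∩ V i ∣ ≡ lookup t i

  profile : KSubset n k → Vec ℕ c
  profile (A , _) = tabulate (λ i → ∣ A ∩ V i ∣)

  Layer⇒profile : ∀ {t} A → Layer t A → profile A ≡ t
  Layer⇒profile {t} A A∈t = trans (tabulate-cong A∈t) (tabulate∘lookup t)

  sum-profile : ∀ A → sum (profile A) ≡ ∣ proj₁ A ─ S ∣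
  sum-profile (A , _) = ∣partition∣ (λ i → A ∩ V i) (A ─ S)
    (λ i v∈ → let v∈A , v∈V = x∈p∩q⁻ A (V i) v∈ in x∈p∧x∉q⇒x∈p─q v∈A (avoids i v∈V))
    (λ {v} v∈ → let i , v∈V = covers v (x∈p─q⇒x∉q {p = A} v∈)
                in i , x∈p∩q⁺ (p─q⊆p A S v∈ , v∈V))
    (λ {i} {j} v∈ v∈′ → disjoint (proj₂ (x∈p∩q⁻ A (V i) v∈)) (proj₂ (x∈p∩q⁻ A (V j) v∈′)))

  Layer⇒∣A∩S∣≡1 : ∀ {t} → T t → ∀ A → Layer t A → ∣ proj₁ A ∩ S ∣ ≡ 1
  Layer⇒∣A∩S∣≡1 {t} (_ , 1+sum≡k) A′@(A , ∣A∣≡k) A∈t = +-cancelʳ-≡ (sum t) _ _ (begin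
    ∣ A ∩ S ∣ + sum t            ≡⟨ cong (λ t → ∣ A ∩ S ∣ + sum t) (Layer⇒profile {t} A′ A∈t) ⟨
    ∣ A ∩ S ∣ + sum (profile A′) ≡⟨ cong (∣ A ∩ S ∣ +_) (sum-profile A′) ⟩
    ∣ A ∩ S ∣ + ∣ A ─ S ∣        ≡⟨ ∣∩∣+∣─∣ A S ⟩
    ∣ A ∣                        ≡⟨ ∣A∣≡k ⟩
    k                            ≡⟨ 1+sum≡k ⟨
    1 + sum t                    ∎)
    where open ≡-Reasoning

  flip : (A : KSubset n k) → ∣ proj₁ A ∩ S ∣ ≡ 1 → KSubset n k
  flip (A , ∣A∣≡k) one = A △ S , +-cancelʳ-≡ 2 _ _ (begin
    ∣ A △ S ∣ + 2                         ≡⟨ cong (λ j → ∣ A △ S ∣ + (j + j)) one ⟨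
    ∣ A △ S ∣ + (∣ A ∩ S ∣ + ∣ A ∩ S ∣)   ≡⟨ ∣△∣ A S ⟩
    ∣ A ∣ + ∣ S ∣                         ≡⟨ cong₂ _+_ ∣A∣≡k (∣pair∣ x≢y) ⟩
    k + 2                                 ∎)
    where open ≡-Reasoning

  -- Decidability of α, automatic classically, lets φ be a function by cases.
  module _ {α : Pred (Vec ℕ c) 0ℓ} (α? : Decidable α) (α⊆T : α U.⊆ T) where

    inLayer? : (A : KSubset n k) → Dec (∃[ t ] α t × Layer t A)
    inLayer? A′@(A , _) with α? (profile A′)
    ... | yes p∈α = yes (profile A′ , p∈α , λ i → sym (lookup∘tabulate _ i))
    ... | no  p∉α = no λ { (t , t∈α , A∈t) →
                      p∉α (subst α (sym (Layer⇒profile {t} A′ A∈t)) t∈α) }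

    φ : KSubset n k → KSubset n k
    φ A with inLayer? A
    ... | yes (t , t∈α , A∈t) = flip A (Layer⇒∣A∩S∣≡1 {t} (α⊆T t∈α) A A∈t)
    ... | no  _               = A

{-# OPTIONS --safe #-}

-- φ is an involution, and it preserves adjacency because a token moving
-- between x and a component can equally well move between y and that
-- component.  To see which φ are induced, realise t ∈ T by the two sets
-- Aˣ = {x} ∪ B and Aʸ = {y} ∪ B.  The vertex f x lies in f(Aˣ) but not in
-- f(Aʸ).  If φ is ι f, this forces f x = y when t ∈ α and f x = x when
-- t ∉ α; if φ is 𝔠 ∘ ι f, the two cases are interchanged.  So membership
-- of t in α does not depend on t.  Conversely φ is ι of the identity when
-- α = ∅, and ι of the transposition of x and y when α = T.

module Submission where

open import Defs
open import Level using (0ℓ)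
open import Data.Bool.Base using (true; false)
open import Data.Fin.Base using (Fin; zero; suc)
open import Data.Fin.Permutation.Components using (transpose)
open import Data.Fin.Properties using (_≟_)
open import Data.Fin.Subset
  using (Subset; ⊥; ⁅_⁆; _∈_; _∉_; _∩_; _∪_; _─_; ∁; ∣_∣)
  renaming (_⊆_ to _⊆ₛ_)
open import Data.Fin.Subset.Properties
open import Data.Nat.Base using (ℕ; zero; suc; _+_; _*_; _≤_; _<_; z≤n; s≤s)
open import Data.Nat.Properties using (≡-irrelevant; +-cancelʳ-≡)
open import Data.Product using (Σ-syntax; ∃-syntax; _×_; _,_; proj₁; proj₂)
open import Data.Sum using (_⊎_; inj₁; inj₂; [_,_]′)
open import Data.Vec.Base using (Vec; []; _∷_; lookup; tabulate; sum)
open import Data.Vec.Properties using (tabulate-cong; tabulate∘lookup; lookup∘tabulate)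
open import Function.Base using (id; _∘_)
open import Function.Bundles using (_⇔_; mk⇔; Equivalence)
open import Function.Consequences.Propositional
  using (strictlySurjective⇒surjective)
open import Relation.Binary.Construct.Closure.ReflexiveTransitive using (ε; _◅_)
open import Relation.Binary.PropositionalEquality
  using (_≡_; _≢_; refl; sym; trans; cong; cong₂; subst; subst₂; module ≡-Reasoning)
open import Relation.Nullary using (¬_; Dec; yes; no; contradiction)
open import Relation.Nullary.Decidable using (dec-true; dec-false; decidable-stable)
open import Relation.Unary using (Pred; Decidable; _⊆_; _≐_; ∅)

open ≡-Reasoning

private
  variable
    m n k : ℕ

-- Subsets of Fin n

-- `△` is coordinatewise exclusive or, so the cases are the rows of its truth table.
△-assoc : (A B C : Subset n) → (A △ B) △ C ≡ A △ (B △ C)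
△-assoc []          []          []          = refl
△-assoc (true  ∷ A) (true  ∷ B) (true  ∷ C) = cong (_ ∷_) (△-assoc A B C)
△-assoc (true  ∷ A) (true  ∷ B) (false ∷ C) = cong (_ ∷_) (△-assoc A B C)
△-assoc (true  ∷ A) (false ∷ B) (true  ∷ C) = cong (_ ∷_) (△-assoc A B C)
△-assoc (true  ∷ A) (false ∷ B) (false ∷ C) = cong (_ ∷_) (△-assoc A B C)
△-assoc (false ∷ A) (true  ∷ B) (true  ∷ C) = cong (_ ∷_) (△-assoc A B C)
△-assoc (false ∷ A) (true  ∷ B) (false ∷ C) = cong (_ ∷_) (△-assoc A B C)
△-assoc (false ∷ A) (false ∷ B) (true  ∷ C) = cong (_ ∷_) (△-assoc A B C)
△-assoc (false ∷ A) (false ∷ B) (false ∷ C) = cong (_ ∷_) (△-assoc A B C)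

△-identityʳ : (A : Subset n) → A △ ⊥ ≡ A
△-identityʳ []          = refl
△-identityʳ (true  ∷ A) = cong (_ ∷_) (△-identityʳ A)
△-identityʳ (false ∷ A) = cong (_ ∷_) (△-identityʳ A)

△-cancelʳ : (A B : Subset n) → (A △ B) △ B ≡ A
△-cancelʳ A B = begin
  (A △ B) △ B ≡⟨ △-assoc A B B ⟩
  A △ (B △ B) ≡⟨ cong (A △_) (△-self B) ⟩
  A △ ⊥       ≡⟨ △-identityʳ A ⟩
  A           ∎

△-swapʳ : (A B C : Subset n) → (A △ B) △ C ≡ (A △ C) △ B
△-swapʳ A B C = begin
  (A △ B) △ C ≡⟨ △-assoc A B C ⟩
  A △ (B △ C) ≡⟨ cong (A △_) (△-comm B C) ⟩
  A △ (C △ B) ≡⟨ △-assoc A C B ⟨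
  (A △ C) △ B ∎

-- For two adjacent token sets that are both flipped: the symmetric difference, and with it the edge
-- along which the token moves, stays the same.
△-translate : (A B C : Subset n) → (A △ C) △ (B △ C) ≡ A △ B
△-translate A B C = begin
  (A △ C) △ (B △ C) ≡⟨ △-swapʳ A C (B △ C) ⟩
  (A △ (B △ C)) △ C ≡⟨ cong (_△ C) (△-assoc A B C) ⟨
  ((A △ B) △ C) △ C ≡⟨ △-cancelʳ (A △ B) C ⟩
  A △ B             ∎

x∈p△q⁻ : ∀ {v} (A B : Subset n) → v ∈ A △ B → (v ∈ A × v ∉ B) ⊎ (v ∈ B × v ∉ A)
x∈p△q⁻ A B v∈ with x∈p∪q⁻ (A ─ B) (B ─ A) v∈
... | inj₁ v∈A─B = inj₁ (p─q⊆p A B v∈A─B , x∈p─q⇒x∉q {p = A} v∈A─B)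
... | inj₂ v∈B─A = inj₂ (p─q⊆p B A v∈B─A , x∈p─q⇒x∉q {p = B} v∈B─A)

x∈p△qˡ : ∀ {v} {A B : Subset n} → v ∈ A → v ∉ B → v ∈ A △ B
x∈p△qˡ v∈A v∉B = x∈p∪q⁺ (inj₁ (x∈p∧x∉q⇒x∈p─q v∈A v∉B))

x∈p△qʳ : ∀ {v} {A B : Subset n} → v ∉ A → v ∈ B → v ∈ A △ B
x∈p△qʳ v∉A v∈B = x∈p∪q⁺ (inj₂ (x∈p∧x∉q⇒x∈p─q v∈B v∉A))

x∈⁅u⁆∪⁅v⁆⁻ : ∀ {w} (u v : Fin n) → w ∈ ⁅ u ⁆ ∪ ⁅ v ⁆ → w ≡ u ⊎ w ≡ v
x∈⁅u⁆∪⁅v⁆⁻ u v w∈ with x∈p∪q⁻ ⁅ u ⁆ ⁅ v ⁆ w∈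
... | inj₁ w∈u = inj₁ (x∈⁅y⁆⇒x≡y u w∈u)
... | inj₂ w∈v = inj₂ (x∈⁅y⁆⇒x≡y v w∈v)

u∈⁅u⁆∪q : (u : Fin n) {q : Subset n} → u ∈ ⁅ u ⁆ ∪ q
u∈⁅u⁆∪q u = x∈p∪q⁺ (inj₁ (x∈⁅x⁆ u))

v∈p∪⁅v⁆ : (v : Fin n) {p : Subset n} → v ∈ p ∪ ⁅ v ⁆
v∈p∪⁅v⁆ v = x∈p∪q⁺ (inj₂ (x∈⁅x⁆ v))

-- This is what later pins down `f x`: two sets that differ only in the inserted vertex leave no
-- other choice.
∈-insert-∖ : ∀ {u v w : Fin n} {B} → w ∈ ⁅ u ⁆ ∪ B → w ∉ ⁅ v ⁆ ∪ B → w ≡ u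
∈-insert-∖ {u = u} {B = B} w∈ w∉ with x∈p∪q⁻ ⁅ u ⁆ B w∈
... | inj₁ w∈u = x∈⁅y⁆⇒x≡y u w∈u
... | inj₂ w∈B = contradiction (x∈p∪q⁺ (inj₂ w∈B)) w∉

∉-insert : ∀ {u v : Fin n} {B} → u ≢ v → u ∉ B → u ∉ ⁅ v ⁆ ∪ B
∉-insert {v = v} {B} u≢v u∉B u∈ with x∈p∪q⁻ ⁅ v ⁆ B u∈
... | inj₁ u∈v = u≢v (x∈⁅y⁆⇒x≡y v u∈v)
... | inj₂ u∈B = u∉B u∈B

-- Used in two ways: with `B` the tokens off `S`, where flipping moves the token on `S` to its twin,
-- and with `B` a singleton, where one end of an edge is exchanged for its twin.
insert-△-pair : ∀ {u v : Fin n} {B} → u ≢ v → u ∉ B → v ∉ B →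
                (⁅ u ⁆ ∪ B) △ (⁅ u ⁆ ∪ ⁅ v ⁆) ≡ ⁅ v ⁆ ∪ B
insert-△-pair {u = u} {v} {B} u≢v u∉B v∉B = ⊆-antisym ⊆₁ ⊆₂
  where
  ⊆₁ : (⁅ u ⁆ ∪ B) △ (⁅ u ⁆ ∪ ⁅ v ⁆) ⊆ₛ ⁅ v ⁆ ∪ B
  ⊆₁ w∈ with x∈p△q⁻ (⁅ u ⁆ ∪ B) (⁅ u ⁆ ∪ ⁅ v ⁆) w∈
  ... | inj₁ (w∈uB , w∉uv) with x∈p∪q⁻ ⁅ u ⁆ B w∈uB
  ...   | inj₁ w∈u = contradiction (x∈p∪q⁺ (inj₁ w∈u)) w∉uv
  ...   | inj₂ w∈B = x∈p∪q⁺ (inj₂ w∈B)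
  ⊆₁ w∈ | inj₂ (w∈uv , w∉uB) with x∈p∪q⁻ ⁅ u ⁆ ⁅ v ⁆ w∈uv
  ...   | inj₁ w∈u = contradiction (x∈p∪q⁺ (inj₁ w∈u)) w∉uB
  ...   | inj₂ w∈v = x∈p∪q⁺ (inj₁ w∈v)
  ⊆₂ : ⁅ v ⁆ ∪ B ⊆ₛ (⁅ u ⁆ ∪ B) △ (⁅ u ⁆ ∪ ⁅ v ⁆)
  ⊆₂ w∈ with x∈p∪q⁻ ⁅ v ⁆ B w∈
  ... | inj₂ w∈B = x∈p△qˡ (x∈p∪q⁺ (inj₂ w∈B)) λ w∈uv →
    [ (λ { refl → u∉B w∈B }) , (λ { refl → v∉B w∈B }) ]′ (x∈⁅u⁆∪⁅v⁆⁻ u v w∈uv)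
  ... | inj₁ w∈v with refl ← x∈⁅y⁆⇒x≡y v w∈v =
    x∈p△qʳ (∉-insert (u≢v ∘ sym) v∉B) (v∈p∪⁅v⁆ v)

∩-cong-off-△ : (A B W : Subset n) → (∀ {v} → v ∈ W → v ∉ A △ B) → A ∩ W ≡ B ∩ W
∩-cong-off-△ A B W off = ⊆-antisym
  (λ v∈ → let v∈A , v∈W = x∈p∩q⁻ A W v∈ in
    x∈p∩q⁺ (decidable-stable (_ ∈? B) (off v∈W ∘ x∈p△qˡ v∈A) , v∈W))
  (λ v∈ → let v∈B , v∈W = x∈p∩q⁻ B W v∈ in
    x∈p∩q⁺ (decidable-stable (_ ∈? A) (λ v∉A → off v∈W (x∈p△qʳ v∉A v∈B)) , v∈W))

p─q≡p∩∁q : (p q : Subset n) → p ─ q ≡ p ∩ ∁ q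
p─q≡p∩∁q p q = ⊆-antisym
  (λ v∈ → x∈p∩q⁺ (p─q⊆p p q v∈ , x∉p⇒x∈∁p (x∈p─q⇒x∉q {p = p} v∈)))
  (λ v∈ → let v∈p , v∈∁q = x∈p∩q⁻ p (∁ q) v∈ in x∈p∧x∉q⇒x∈p─q v∈p (x∈∁p⇒x∉p v∈∁q))

-- The two sets agree outside `W`; as their total sizes are equal, so are the sizes of what remains
-- inside `W`.
∣∩∣-cong-△⊆ : (A B W : Subset n) → ∣ A ∣ ≡ ∣ B ∣ → A △ B ⊆ₛ W → ∣ A ∩ W ∣ ≡ ∣ B ∩ W ∣
∣∩∣-cong-△⊆ A B W ∣A∣≡∣B∣ △⊆W = +-cancelʳ-≡ ∣ A ─ W ∣ _ _ (begin
  ∣ A ∩ W ∣ + ∣ A ─ W ∣ ≡⟨ ∣∩∣+∣─∣ A W ⟩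
  ∣ A ∣                 ≡⟨ ∣A∣≡∣B∣ ⟩
  ∣ B ∣                 ≡⟨ ∣∩∣+∣─∣ B W ⟨
  ∣ B ∩ W ∣ + ∣ B ─ W ∣ ≡⟨ cong (λ p → ∣ B ∩ W ∣ + ∣ p ∣) A─W≡B─W ⟨
  ∣ B ∩ W ∣ + ∣ A ─ W ∣ ∎)
  where
  A─W≡B─W : A ─ W ≡ B ─ W
  A─W≡B─W = begin
    A ─ W   ≡⟨ p─q≡p∩∁q A W ⟩
    A ∩ ∁ W ≡⟨ ∩-cong-off-△ A B (∁ W) (λ v∈∁W v∈△ → x∈∁p⇒x∉p v∈∁W (△⊆W v∈△)) ⟩
    B ∩ ∁ W ≡⟨ p─q≡p∩∁q B W ⟨
    B ─ W   ∎

subset-of-size : (p : Subset n) → m ≤ ∣ p ∣ → ∃[ q ] q ⊆ₛ p × ∣ q ∣ ≡ m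
subset-of-size {n} {zero} p z≤n = ⊥ , ⊥⊆ , ∣⊥∣≡0 n
subset-of-size {m = suc _} (true ∷ p) (s≤s m≤∣p∣) =
  let q , q⊆p , ∣q∣≡m = subset-of-size p m≤∣p∣ in
  true ∷ q , in⊆in q⊆p , cong suc ∣q∣≡m
subset-of-size {m = suc _} (false ∷ p) m≤∣p∣ =
  let q , q⊆p , ∣q∣≡m = subset-of-size p m≤∣p∣ in
  false ∷ q , out⊆ q⊆p , ∣q∣≡m

union : (P : Fin m → Subset n) → ∃[ B ] (∀ {v} → v ∈ B ⇔ (∃[ i ] v ∈ P i))
union {zero}  P = ⊥ , mk⇔ (λ v∈⊥ → contradiction v∈⊥ ∉⊥) λ ()
union {suc m} P with union (P ∘ suc)
... | B , B⇔ = P zero ∪ B , mk⇔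
  (λ v∈ → [ (zero ,_) , (λ v∈B → let i , v∈Pi = to B⇔ v∈B in suc i , v∈Pi) ]′
            (x∈p∪q⁻ (P zero) B v∈))
  (λ { (zero  , v∈P₀) → x∈p∪q⁺ (inj₁ v∈P₀)
     ; (suc i , v∈Pi) → x∈p∪q⁺ (inj₂ (from B⇔ (i , v∈Pi))) })
  where open Equivalence

KSubset-≡ : {A B : KSubset n k} → proj₁ A ≡ proj₁ B → A ≡ B
KSubset-≡ {A = A , p} {.A , q} refl = cong (A ,_) (≡-irrelevant p q)

-- Involutions

module _ {V : Set} (G : Graph V) where
  open Graph G

  -- Preserving adjacency is enough: applying `f` once more to an edge between images returns the
  -- original pair, which gives the reflecting direction.
  involutive⇒isAutomorphism : {f : V → V} → (∀ v → f (f v) ≡ v) →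
                              (∀ {u v} → u ~ v → f u ~ f v) → IsAutomorphism G f
  involutive⇒isAutomorphism {f} f∘f f-~ = record
    { bijective = (λ {u} {v} fu≡fv → begin
                    u       ≡⟨ f∘f u ⟨
                    f (f u) ≡⟨ cong f fu≡fv ⟩
                    f (f v) ≡⟨ f∘f v ⟩
                    v       ∎)
                , strictlySurjective⇒surjective (λ v → f v , f∘f v)
    ; adjacency = λ {u} {v} → mk⇔ f-~ (λ fu~fv → subst₂ _~_ (f∘f u) (f∘f v) (f-~ fu~fv))
    }

idAut : {V : Set} {G : Graph V} → Automorphism G
idAut {G = G} = mkAut id (involutive⇒isAutomorphism G (λ _ → refl) id)

-- Since `v` is `f (f v)`, mapping `B` into `A` already puts every vertex of `B` into the image of
-- `A`.
image-involutive : {f : Fin n → Fin n} → (∀ v → f (f v) ≡ v) → (A B : Subset n) →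
                   (∀ {v} → v ∈ A → f v ∈ B) → (∀ {v} → v ∈ B → f v ∈ A) → image f A ≡ B
image-involutive {f = f} f∘f A B A→B B→A = ⊆-antisym
  (λ v∈ → let a , a∈A , fa≡v = ∈-image⁻ f A v∈ in subst (_∈ B) fa≡v (A→B a∈A))
  (λ {v} v∈B → subst (_∈ image f A) (f∘f v) (∈-image⁺ f A (B→A v∈B)))

transpose-matchˡ : (i j : Fin n) → transpose i j i ≡ j
transpose-matchˡ i j rewrite dec-true (i ≟ i) refl = refl

transpose-matchʳ : (i j : Fin n) → transpose i j j ≡ i
transpose-matchʳ i j with j ≟ i
... | yes refl = refl
... | no  _    rewrite dec-true (j ≟ j) refl = refl

transpose-mismatch : {i j v : Fin n} → v ∉ ⁅ i ⁆ ∪ ⁅ j ⁆ → transpose i j v ≡ v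
transpose-mismatch {i = i} {j} {v} v∉
  rewrite dec-false (v ≟ i) (λ { refl → v∉ (u∈⁅u⁆∪q i) })
        | dec-false (v ≟ j) (λ { refl → v∉ (v∈p∪⁅v⁆ j) }) = refl

transpose-involutive : (i j v : Fin n) → transpose i j (transpose i j v) ≡ v
transpose-involutive i j v with v ∈? ⁅ i ⁆ ∪ ⁅ j ⁆
... | no v∉ = trans (cong (transpose i j) (transpose-mismatch v∉)) (transpose-mismatch v∉)
... | yes v∈ with x∈⁅u⁆∪⁅v⁆⁻ i j v∈
...   | inj₁ refl = trans (cong (transpose i j) (transpose-matchˡ i j)) (transpose-matchʳ i j)
...   | inj₂ refl = trans (cong (transpose i j) (transpose-matchʳ i j)) (transpose-matchˡ i j)

-- The transposition of the twins x and y

module _ {G : Graph (Fin n)} (cut : TwinCut G) where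
  open Graph G
  open TwinCut cut

  swap : Fin n → Fin n
  swap = transpose x y

  -- Cases on which ends lie in `S`. An edge off `S` is fixed, an edge with one end in `S` is
  -- carried over by `same-neighbours`, and an edge inside `S` is reversed.
  swap-~ : ∀ {u v} → u ~ v → swap u ~ swap v
  swap-~ {u} {v} u~v with u ∈? S | v ∈? S
  ... | no u∉S | no v∉S =
    subst₂ _~_ (sym (transpose-mismatch u∉S)) (sym (transpose-mismatch v∉S)) u~v
  ... | yes u∈S | no v∉S with x∈⁅u⁆∪⁅v⁆⁻ x y u∈S
  ...   | inj₁ refl = subst₂ _~_ (sym (transpose-matchˡ x y)) (sym (transpose-mismatch v∉S))
                        (Equivalence.to (same-neighbours v v∉S) u~v)
  ...   | inj₂ refl = subst₂ _~_ (sym (transpose-matchʳ x y)) (sym (transpose-mismatch v∉S))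
                        (Equivalence.from (same-neighbours v v∉S) u~v)
  swap-~ {u} {v} u~v | no u∉S | yes v∈S with x∈⁅u⁆∪⁅v⁆⁻ x y v∈S
  ...   | inj₁ refl = subst₂ _~_ (sym (transpose-mismatch u∉S)) (sym (transpose-matchˡ x y))
                        (sym-~ (Equivalence.to (same-neighbours u u∉S) (sym-~ u~v)))
  ...   | inj₂ refl = subst₂ _~_ (sym (transpose-mismatch u∉S)) (sym (transpose-matchʳ x y))
                        (sym-~ (Equivalence.from (same-neighbours u u∉S) (sym-~ u~v)))
  swap-~ {u} {v} u~v | yes u∈S | yes v∈S with x∈⁅u⁆∪⁅v⁆⁻ x y u∈S | x∈⁅u⁆∪⁅v⁆⁻ x y v∈S
  ...   | inj₁ refl | inj₁ refl = contradiction u~v (irrefl refl)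
  ...   | inj₂ refl | inj₂ refl = contradiction u~v (irrefl refl)
  ...   | inj₁ refl | inj₂ refl =
    subst₂ _~_ (sym (transpose-matchˡ x y)) (sym (transpose-matchʳ x y)) (sym-~ u~v)
  ...   | inj₂ refl | inj₁ refl =
    subst₂ _~_ (sym (transpose-matchʳ x y)) (sym (transpose-matchˡ x y)) (sym-~ u~v)

  swapAut : Automorphism G
  swapAut = mkAut swap (involutive⇒isAutomorphism G (transpose-involutive x y) swap-~)

  swap-∈ : ∀ (A B : Subset n) → (x ∈ A → y ∈ B) → (y ∈ A → x ∈ B) →
           (∀ {v} → v ∉ S → v ∈ A → v ∈ B) → ∀ {v} → v ∈ A → swap v ∈ B
  swap-∈ A B x→y y→x off {v} v∈A with v ∈? S
  ... | no v∉S = subst (_∈ B) (sym (transpose-mismatch v∉S)) (off v∉S v∈A)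
  ... | yes v∈S with x∈⁅u⁆∪⁅v⁆⁻ x y v∈S
  ...   | inj₁ refl = subst (_∈ B) (sym (transpose-matchˡ x y)) (x→y v∈A)
  ...   | inj₂ refl = subst (_∈ B) (sym (transpose-matchʳ x y)) (y→x v∈A)

  x∈S : x ∈ S
  x∈S = u∈⁅u⁆∪q x

  y∈S : y ∈ S
  y∈S = v∈p∪⁅v⁆ y

  -- `S` enters only through a listing `u`, `v` of its elements, so that the twins can be taken in
  -- either order.
  ∣A∩S∣≡1 : ∀ {u v} {A : Subset n} → (∀ {w} → w ∈ S → w ≡ u ⊎ w ≡ v) → u ∈ S →
                 u ∈ A → v ∉ A → ∣ A ∩ S ∣ ≡ 1
  ∣A∩S∣≡1 {u} {v} {A} S⁻ u∈S u∈A v∉A = trans (cong ∣_∣ A∩S≡u) (∣⁅x⁆∣≡1 u)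
    where
    A∩S≡u : A ∩ S ≡ ⁅ u ⁆
    A∩S≡u = ⊆-antisym
      (λ w∈ → let w∈A , w∈S = x∈p∩q⁻ A S w∈ in
        [ (λ { refl → x∈⁅x⁆ u }) , (λ { refl → contradiction w∈A v∉A }) ]′ (S⁻ w∈S))
      (λ w∈u → x∈p∩q⁺ (subst (λ w → w ∈ A × w ∈ S) (sym (x∈⁅y⁆⇒x≡y u w∈u)) (u∈A , u∈S)))

  -- With exactly one twin in `A`, both operations replace that twin by the other one and leave the
  -- rest of `A` alone.
  image-swap-△ : (A : Subset n) → ∣ A ∩ S ∣ ≡ 1 → image swap A ≡ A △ S
  image-swap-△ A one = image-involutive (transpose-involutive x y) A (A △ S)
    (swap-∈ A (A △ S) (λ x∈A → x∈p△qʳ (¬both x∈A) y∈S)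
                      (λ y∈A → x∈p△qʳ (λ x∈A → ¬both x∈A y∈A) x∈S)
                      (λ v∉S v∈A → x∈p△qˡ v∈A v∉S))
    (swap-∈ (A △ S) A
      (λ x∈ → decidable-stable (y ∈? A) (¬neither (S∩△⇒∉ x∈S x∈)))
      (λ y∈ → decidable-stable (x ∈? A) (λ x∉A → ¬neither x∉A (S∩△⇒∉ y∈S y∈)))
      (λ v∉S v∈ → [ proj₁ , (λ (v∈S , _) → contradiction v∈S v∉S) ]′ (x∈p△q⁻ A S v∈)))
    where
    S∩△⇒∉ : ∀ {v} → v ∈ S → v ∈ A △ S → v ∉ A
    S∩△⇒∉ v∈S v∈ = [ (λ (_ , v∉S) → contradiction v∈S v∉S) , proj₂ ]′ (x∈p△q⁻ A S v∈)
    ¬both : x ∈ A → y ∉ A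
    ¬both x∈A y∈A = contradiction
      (begin
        1         ≡⟨ one ⟨
        ∣ A ∩ S ∣ ≡⟨ cong ∣_∣ (⊆-antisym (p∩q⊆q A S) λ w∈S → x∈p∩q⁺
                       ([ (λ { refl → x∈A }) , (λ { refl → y∈A }) ]′ (x∈⁅u⁆∪⁅v⁆⁻ x y w∈S) , w∈S)) ⟩
        ∣ S ∣     ≡⟨ ∣pair∣ x≢y ⟩
        2         ∎)
      λ ()
    ¬neither : x ∉ A → ¬ y ∉ A
    ¬neither x∉A y∉A = contradiction
      (trans (sym one) (∣empty∣ λ (_ , w∈) → let w∈A , w∈S = x∈p∩q⁻ A S w∈ in
        [ (λ { refl → x∉A w∈A }) , (λ { refl → y∉A w∈A }) ]′ (x∈⁅u⁆∪⁅v⁆⁻ x y w∈S)))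
      λ ()

  -- Here `A` contains both twins or neither, so exchanging them does not change it.
  image-swap-fixed : (A : Subset n) → ∣ A ∩ S ∣ ≢ 1 → image swap A ≡ A
  image-swap-fixed A ≢1 = image-involutive (transpose-involutive x y) A A swap∈ swap∈
    where
    swap∈ : ∀ {v} → v ∈ A → swap v ∈ A
    swap∈ = swap-∈ A A
      (λ x∈A → decidable-stable (y ∈? A)
        (≢1 ∘ ∣A∩S∣≡1 (x∈⁅u⁆∪⁅v⁆⁻ x y) x∈S x∈A))
      (λ y∈A → decidable-stable (x ∈? A)
        (≢1 ∘ ∣A∩S∣≡1 ([ inj₂ , inj₁ ]′ ∘ x∈⁅u⁆∪⁅v⁆⁻ x y) y∈S y∈A))
      (λ _ → id)

-- Profiles of token sets and how moves change them

module _ {G : Graph (Fin n)} (k : ℕ) (cut : TwinCut G)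
         (comps : Components G (TwinCut.S cut)) where
  open Graph G
  open TwinCut cut hiding (cut)
  open Components comps hiding (injective)

  same-component : ∀ {u v i} → u ~ v → v ∉ S → u ∈ V i → v ∈ V i
  same-component {i = i} u~v v∉S u∈Vi =
    Equivalence.from (proj₂ (isComponent i) {_ , avoids i u∈Vi} {_ , v∉S} u∈Vi) (u~v ◅ ε)

  -- Together with `T-profile⁺`: the profile sums to the number of tokens off `S`, so it lies in `T`
  -- exactly when one token is left for `S`.
  T-profile⁻ : ∀ A → T k cut comps (profile k cut comps A) → ∣ proj₁ A ∩ S ∣ ≡ 1
  T-profile⁻ A p∈T =
    Layer⇒∣A∩S∣≡1 k cut comps {profile k cut comps A} p∈T A λ i → sym (lookup∘tabulate _ i)

  T-profile⁺ : ∀ A → ∣ proj₁ A ∩ S ∣ ≡ 1 → T k cut comps (profile k cut comps A)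
  T-profile⁺ A@(p , ∣p∣≡k) one =
    (λ i → subst (_≤ ∣ V i ∣) (sym (lookup∘tabulate _ i)) (∣p∩q∣≤∣q∣ p (V i))) , (begin
      1 + sum (profile k cut comps A) ≡⟨ cong suc (sum-profile k cut comps A) ⟩
      1 + ∣ p ─ S ∣                   ≡⟨ cong (_+ ∣ p ─ S ∣) one ⟨
      ∣ p ∩ S ∣ + ∣ p ─ S ∣           ≡⟨ ∣∩∣+∣─∣ p S ⟩
      ∣ p ∣                           ≡⟨ ∣p∣≡k ⟩
      k                               ∎)

  -- A profile counts only vertices in components, all of which avoid `S`.
  △⊆S⇒profile-≡ : (A B : KSubset n k) → proj₁ A △ proj₁ B ⊆ₛ S →
                  profile k cut comps A ≡ profile k cut comps B
  △⊆S⇒profile-≡ (p , _) (q , _) △⊆S = tabulate-cong λ i →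
    cong ∣_∣ (∩-cong-off-△ p q (V i) λ v∈Vi v∈△ → avoids i v∈Vi (△⊆S v∈△))

  -- An edge off `S` stays in one component: the token moves within that component, whose count is
  -- kept because the total is, and every other component is untouched.
  pair∩S≡∅⇒profile-≡ : ∀ {u v} (A B : KSubset n k) → u ~ v →
                       proj₁ A △ proj₁ B ≡ ⁅ u ⁆ ∪ ⁅ v ⁆ → u ∉ S → v ∉ S →
                       profile k cut comps A ≡ profile k cut comps B
  pair∩S≡∅⇒profile-≡ {u} {v} (p , ∣p∣≡k) (q , ∣q∣≡k) u~v △≡uv u∉S v∉S = tabulate-cong same
    where
    same : ∀ j → ∣ p ∩ V j ∣ ≡ ∣ q ∩ V j ∣
    same j with u ∈? V j
    ... | yes u∈Vj = ∣∩∣-cong-△⊆ p q (V j) (trans ∣p∣≡k (sym ∣q∣≡k)) λ w∈△ →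
      [ (λ { refl → u∈Vj }) , (λ { refl → same-component u~v v∉S u∈Vj }) ]′
        (x∈⁅u⁆∪⁅v⁆⁻ u v (subst (_ ∈_) △≡uv w∈△))
    ... | no u∉Vj = cong ∣_∣ (∩-cong-off-△ p q (V j) λ w∈Vj w∈△ →
      [ (λ { refl → u∉Vj w∈Vj })
      , (λ { refl → u∉Vj (same-component (sym-~ u~v) u∉S w∈Vj) }) ]′
        (x∈⁅u⁆∪⁅v⁆⁻ u v (subst (_ ∈_) △≡uv w∈△)))

  -- The vertex `u′` is the twin of `u`; it is adjacent to `v` because `v` lies off `S`.
  twin-pair : ∀ {u v} → u ~ v → u ∈ S → v ∉ S →
              ∃[ u′ ] u′ ~ v × (⁅ u ⁆ ∪ ⁅ v ⁆) △ S ≡ ⁅ u′ ⁆ ∪ ⁅ v ⁆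
  twin-pair {u} {v} u~v u∈S v∉S = shift (x∈⁅u⁆∪⁅v⁆⁻ x y u∈S)
    where
    ∉⁅v⁆ : ∀ {w} → w ∈ S → w ∉ ⁅ v ⁆
    ∉⁅v⁆ w∈S w∈v = v∉S (subst (_∈ S) (x∈⁅y⁆⇒x≡y v w∈v) w∈S)
    shift : u ≡ x ⊎ u ≡ y → ∃[ u′ ] u′ ~ v × (⁅ u ⁆ ∪ ⁅ v ⁆) △ S ≡ ⁅ u′ ⁆ ∪ ⁅ v ⁆
    shift (inj₁ refl) = y , Equivalence.to (same-neighbours v v∉S) u~v ,
      insert-△-pair x≢y (∉⁅v⁆ (x∈S cut)) (∉⁅v⁆ (y∈S cut))
    shift (inj₂ refl) = x , Equivalence.from (same-neighbours v v∉S) u~v , (begin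
      (⁅ y ⁆ ∪ ⁅ v ⁆) △ S               ≡⟨ cong ((⁅ y ⁆ ∪ ⁅ v ⁆) △_) (∪-comm ⁅ x ⁆ ⁅ y ⁆) ⟩
      (⁅ y ⁆ ∪ ⁅ v ⁆) △ (⁅ y ⁆ ∪ ⁅ x ⁆) ≡⟨ insert-△-pair (x≢y ∘ sym) (∉⁅v⁆ (y∈S cut)) (∉⁅v⁆ (x∈S cut)) ⟩
      ⁅ x ⁆ ∪ ⁅ v ⁆                     ∎)

  -- Choose `lookup t i` vertices in each component and let `B` be their union. One more vertex from
  -- `S` brings the size to `k` without affecting the profile, so the same `B` serves both twins.
  realise : ∀ {t} → T k cut comps t →
            ∃[ B ] x ∉ B × y ∉ B ×
              (∀ u → u ∈ S → Σ[ ∣u∪B∣≡k ∈ ∣ ⁅ u ⁆ ∪ B ∣ ≡ k ]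
                profile k cut comps (⁅ u ⁆ ∪ B , ∣u∪B∣≡k) ≡ t)
  realise {t} (t≤ , 1+sum≡k) = B , S∌B (x∈S cut) , S∌B (y∈S cut) , λ u u∈S →
    let ∣u∪B∣≡k = trans (∣insert∣ (S∌B u∈S)) (trans (cong suc ∣B∣≡sum) 1+sum≡k) in
    ∣u∪B∣≡k , Layer⇒profile k cut comps {t} (⁅ u ⁆ ∪ B , ∣u∪B∣≡k) (λ i →
      trans (cong ∣_∣ (u∪B∩V≡U u∈S i)) (∣U∣≡t i))
    where
    part = λ i → subset-of-size (V i) (t≤ i)
    U = λ i → proj₁ (part i)
    U⊆V : ∀ i → U i ⊆ₛ V i
    U⊆V i = proj₁ (proj₂ (part i))
    ∣U∣≡t : ∀ i → ∣ U i ∣ ≡ lookup t i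
    ∣U∣≡t i = proj₂ (proj₂ (part i))
    B = proj₁ (union U)
    ∈B⁻ : ∀ {v} → v ∈ B → ∃[ i ] v ∈ U i
    ∈B⁻ = Equivalence.to (proj₂ (union U))
    ∈B⁺ : ∀ i {v} → v ∈ U i → v ∈ B
    ∈B⁺ i v∈U = Equivalence.from (proj₂ (union U)) (i , v∈U)
    S∌B : ∀ {v} → v ∈ S → v ∉ B
    S∌B v∈S v∈B = let i , v∈U = ∈B⁻ v∈B in avoids i (U⊆V i v∈U) v∈S
    ∣B∣≡sum : ∣ B ∣ ≡ sum t
    ∣B∣≡sum = begin
      ∣ B ∣                          ≡⟨ ∣partition∣ U B ∈B⁺ ∈B⁻
                                         (λ {i} {j} v∈i v∈j → disjoint (U⊆V i v∈i) (U⊆V j v∈j)) ⟨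
      sum (tabulate (λ i → ∣ U i ∣)) ≡⟨ cong sum (tabulate-cong ∣U∣≡t) ⟩
      sum (tabulate (lookup t))      ≡⟨ cong sum (tabulate∘lookup t) ⟩
      sum t                          ∎
    u∪B∩V≡U : ∀ {u} → u ∈ S → ∀ i → (⁅ u ⁆ ∪ B) ∩ V i ≡ U i
    u∪B∩V≡U {u} u∈S i = ⊆-antisym
      (λ v∈ → let v∈uB , v∈V = x∈p∩q⁻ (⁅ u ⁆ ∪ B) (V i) v∈ in
        [ (λ v∈u → contradiction (subst (_∈ S) (sym (x∈⁅y⁆⇒x≡y u v∈u)) u∈S) (avoids i v∈V))
        -- The vertex was chosen in some component `j`; since it also lies in `V i`, disjointness
        -- gives `j ≡ i`.
        , (λ v∈B → let j , v∈U = ∈B⁻ v∈B in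
            subst (λ i → _ ∈ U i) (disjoint (U⊆V j v∈U) v∈V) v∈U) ]′
          (x∈p∪q⁻ ⁅ u ⁆ B v∈uB))
      (λ v∈U → x∈p∩q⁺ (x∈p∪q⁺ (inj₂ (∈B⁺ i v∈U)) , U⊆V i v∈U))

  -- The map φ is an automorphism of the token graph

  module _ {α : Pred (Vec ℕ c) 0ℓ} (α? : Decidable α) (α⊆T : α ⊆ T k cut comps) where
    open Graph (tokenGraph k G) using () renaming (_~_ to _~ᵗ_; sym-~ to sym-~ᵗ)

    prof : KSubset n k → Vec ℕ c
    prof = profile k cut comps

    Φ : KSubset n k → KSubset n k
    Φ = φ k cut comps α? α⊆T

    -- With `φ-fixes`, this reduces `φ` to a test on the profile, since the only layer that can
    -- contain `A` is the one indexed by `prof A`.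
    φ-flips : ∀ {A} → α (prof A) → proj₁ (Φ A) ≡ proj₁ A △ S
    φ-flips {A} p∈α with inLayer? k cut comps α? α⊆T A
    ... | yes _ = refl
    ... | no ¬layer =
      contradiction (prof A , p∈α , λ i → sym (lookup∘tabulate _ i)) ¬layer

    φ-fixes : ∀ {A} → ¬ α (prof A) → Φ A ≡ A
    φ-fixes {A} p∉α with inLayer? k cut comps α? α⊆T A
    ... | yes (t , t∈α , A∈t) =
      contradiction (subst α (sym (Layer⇒profile k cut comps {t} A A∈t)) t∈α) p∉α
    ... | no _ = refl

    -- Flipping changes nothing off `S`, so the image stays in its layer and a second application
    -- flips it back.
    profile-φ : ∀ {A} → α (prof A) → prof (Φ A) ≡ prof A
    profile-φ {A@(p , _)} p∈α = △⊆S⇒profile-≡ (Φ A) A (subst (_ ∈_) (begin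
      proj₁ (Φ A) △ p ≡⟨ cong (_△ p) (φ-flips p∈α) ⟩
      (p △ S) △ p     ≡⟨ cong (_△ p) (△-comm p S) ⟩
      (S △ p) △ p     ≡⟨ △-cancelʳ S p ⟩
      S               ∎))

    φ-involutive : ∀ A → Φ (Φ A) ≡ A
    φ-involutive A@(p , _) = by-cases (α? (prof A))
      where
      by-cases : Dec (α (prof A)) → Φ (Φ A) ≡ A
      by-cases (no  p∉α) = trans (cong Φ (φ-fixes p∉α)) (φ-fixes p∉α)
      by-cases (yes p∈α) = KSubset-≡ (begin
        proj₁ (Φ (Φ A)) ≡⟨ φ-flips (subst α (sym (profile-φ p∈α)) p∈α) ⟩
        proj₁ (Φ A) △ S ≡⟨ cong (_△ S) (φ-flips p∈α) ⟩
        (p △ S) △ S     ≡⟨ △-cancelʳ p S ⟩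
        p               ∎)

    -- The profiles differ, so the token moves along an edge with exactly one end in `S`; an edge
    -- with both ends in `S` or both off `S` would preserve the profile. Flipping `A` alone replaces
    -- the end in `S` by its twin, which is again an edge.
    φ-~-mixed : ∀ {A B} → α (prof A) → ¬ α (prof B) → A ~ᵗ B → Φ A ~ᵗ Φ B
    φ-~-mixed {A@(p , _)} {B@(q , _)} A∈α B∉α (u , v , u~v , △≡uv) =
      subst (Φ A ~ᵗ_) (sym (φ-fixes B∉α)) ΦA~B
      where
      prof≢ : prof A ≢ prof B
      prof≢ eq = B∉α (subst α eq A∈α)
      ΦA△B≡ : ∀ {P} → p △ q ≡ P → proj₁ (Φ A) △ q ≡ P △ S
      ΦA△B≡ {P} △≡P = begin
        proj₁ (Φ A) △ q ≡⟨ cong (_△ q) (φ-flips A∈α) ⟩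
        (p △ S) △ q     ≡⟨ △-swapʳ p S q ⟩
        (p △ q) △ S     ≡⟨ cong (_△ S) △≡P ⟩
        P △ S           ∎
      -- Takes its own `u` and `v`, so that the edge can be read from either end.
      crossing : ∀ {u v} → u ~ v → p △ q ≡ ⁅ u ⁆ ∪ ⁅ v ⁆ → u ∈ S → v ∉ S → Φ A ~ᵗ B
      crossing u~v △≡uv u∈S v∉S =
        let u′ , u′~v , △S≡u′v = twin-pair u~v u∈S v∉S in
        u′ , _ , u′~v , trans (ΦA△B≡ △≡uv) △S≡u′v
      ΦA~B : Φ A ~ᵗ B
      ΦA~B with u ∈? S | v ∈? S
      ... | yes u∈S | no  v∉S = crossing u~v △≡uv u∈S v∉S
      ... | no  u∉S | yes v∈S =
        crossing (sym-~ u~v) (trans △≡uv (∪-comm ⁅ u ⁆ ⁅ v ⁆)) v∈S u∉S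
      ... | no  u∉S | no  v∉S =
        contradiction (pair∩S≡∅⇒profile-≡ A B u~v △≡uv u∉S v∉S) prof≢
      ... | yes u∈S | yes v∈S = contradiction (△⊆S⇒profile-≡ A B λ w∈△ →
        [ (λ { refl → u∈S }) , (λ { refl → v∈S }) ]′
          (x∈⁅u⁆∪⁅v⁆⁻ u v (subst (_ ∈_) △≡uv w∈△))) prof≢

    φ-~ : ∀ {A B} → A ~ᵗ B → Φ A ~ᵗ Φ B
    φ-~ {A@(p , _)} {B@(q , _)} A~B@(u , v , u~v , △≡uv) = by-cases (α? (prof A)) (α? (prof B))
      where
      by-cases : Dec (α (prof A)) → Dec (α (prof B)) → Φ A ~ᵗ Φ B
      by-cases (yes A∈α) (no  B∉α) = φ-~-mixed A∈α B∉α A~B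
      by-cases (no  A∉α) (yes B∈α) =
        sym-~ᵗ {Φ B} {Φ A} (φ-~-mixed B∈α A∉α (sym-~ᵗ {A} {B} A~B))
      by-cases (no  A∉α) (no  B∉α) =
        subst₂ _~ᵗ_ (sym (φ-fixes A∉α)) (sym (φ-fixes B∉α)) A~B
      by-cases (yes A∈α) (yes B∈α) = u , v , u~v , (begin
        proj₁ (Φ A) △ proj₁ (Φ B) ≡⟨ cong₂ _△_ (φ-flips A∈α) (φ-flips B∈α) ⟩
        (p △ S) △ (q △ S)         ≡⟨ △-translate p q S ⟩
        p △ q                     ≡⟨ △≡uv ⟩
        ⁅ u ⁆ ∪ ⁅ v ⁆             ∎)

    φ-isAutomorphism : IsAutomorphism (tokenGraph k G) Φ
    φ-isAutomorphism = involutive⇒isAutomorphism (tokenGraph k G) φ-involutive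
      (λ {A} {B} → φ-~ {A} {B})

    -- The pair Aˣ, Aʸ of the header.
    record Twins (t : Vec ℕ c) : Set where
      field
        Aˣ Aʸ    : KSubset n k
        x∈Aˣ     : x ∈ proj₁ Aˣ
        x∉Aʸ     : x ∉ proj₁ Aʸ
        ∈Aˣ∖Aʸ   : ∀ {w} → w ∈ proj₁ Aˣ → w ∉ proj₁ Aʸ → w ≡ x
        ∈Aʸ∖Aˣ   : ∀ {w} → w ∈ proj₁ Aʸ → w ∉ proj₁ Aˣ → w ≡ y
        swapped  : α t → Φ Aˣ ≡ Aʸ × Φ Aʸ ≡ Aˣ
        fixed    : ¬ α t → Φ Aˣ ≡ Aˣ × Φ Aʸ ≡ Aʸ

    -- Both sets consist of the same `B` and one twin and have profile `t`, so `φ` treats them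
    -- alike: it exchanges them or fixes both.
    twins : ∀ {t} → T k cut comps t → Twins t
    twins t∈T = let B , x∉B , y∉B , A[_] = realise t∈T
                    ∣Aˣ∣≡k , profˣ = A[ x ] (x∈S cut)
                    ∣Aʸ∣≡k , profʸ = A[ y ] (y∈S cut) in record
      { Aˣ      = ⁅ x ⁆ ∪ B , ∣Aˣ∣≡k
      ; Aʸ      = ⁅ y ⁆ ∪ B , ∣Aʸ∣≡k
      ; x∈Aˣ    = u∈⁅u⁆∪q x
      ; x∉Aʸ    = ∉-insert x≢y x∉B
      ; ∈Aˣ∖Aʸ  = ∈-insert-∖
      ; ∈Aʸ∖Aˣ  = ∈-insert-∖
      ; swapped = λ t∈α →
          KSubset-≡ (trans (φ-flips (subst α (sym profˣ) t∈α)) (insert-△-pair x≢y x∉B y∉B))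
        , KSubset-≡ (trans (φ-flips (subst α (sym profʸ) t∈α))
            (trans (cong ((⁅ y ⁆ ∪ B) △_) (∪-comm ⁅ x ⁆ ⁅ y ⁆))
                   (insert-△-pair (x≢y ∘ sym) y∉B x∉B)))
      ; fixed   = λ t∉α → φ-fixes (t∉α ∘ subst α profˣ) , φ-fixes (t∉α ∘ subst α profʸ)
      }

    -- `P` does not mention `t`: deciding it once settles membership in `α` for all of `T` together.
    -- It will be a condition on `f x`.
    α-trivial : ∀ {P : Set} → Dec P → (∀ {t} → T k cut comps t → α t → P) →
                (∀ {t} → T k cut comps t → ¬ α t → ¬ P) → α ≐ ∅ ⊎ α ≐ T k cut comps
    α-trivial (no ¬p) in-α _ = inj₁ ((λ t∈α → ¬p (in-α (α⊆T t∈α) t∈α)) , λ ())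
    α-trivial (yes p) _ out-α =
      inj₂ (α⊆T , λ t∈T → decidable-stable (α? _) λ t∉α → out-α t∈T t∉α p)

    -- An induced φ forces α to be empty or all of T

    module _ (f : Automorphism G) where
      open Automorphism f

      module _ {t} (tw : Twins t) where
        open Twins tw

        fx∈fAˣ : to x ∈ image to (proj₁ Aˣ)
        fx∈fAˣ = ∈-image⁺ to _ x∈Aˣ

        fx∉fAʸ : to x ∉ image to (proj₁ Aʸ)
        fx∉fAʸ fx∈ = let a , a∈Aʸ , fa≡fx = ∈-image⁻ to _ fx∈ in
          x∉Aʸ (subst (_∈ _) (injective fa≡fx) a∈Aʸ)

        module _ (φ≡ι : ∀ A → Φ A ≡ ι f A) where

          private
            image≡ : ∀ {A B} → Φ A ≡ B → image to (proj₁ A) ≡ proj₁ B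
            image≡ {A} ΦA≡B = cong proj₁ (trans (sym (φ≡ι A)) ΦA≡B)

          -- The images of `Aˣ` and `Aʸ` are now `Aʸ` and `Aˣ`, so `f x` lies in `Aʸ` but not in
          -- `Aˣ`.
          ι-swapped⇒fx≡y : α t → to x ≡ y
          ι-swapped⇒fx≡y t∈α = let Φˣ , Φʸ = swapped t∈α in
            ∈Aʸ∖Aˣ (subst (to x ∈_) (image≡ Φˣ) fx∈fAˣ) (subst (to x ∉_) (image≡ Φʸ) fx∉fAʸ)

          ι-fixed⇒fx≡x : ¬ α t → to x ≡ x
          ι-fixed⇒fx≡x t∉α = let Φˣ , Φʸ = fixed t∉α in
            ∈Aˣ∖Aʸ (subst (to x ∈_) (image≡ Φˣ) fx∈fAˣ) (subst (to x ∉_) (image≡ Φʸ) fx∉fAʸ)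

        module _ (n≡2k : n ≡ 2 * k) (φ≡𝔠∘ι : ∀ A → Φ A ≡ 𝔠 n≡2k (ι f A)) where

          private
            -- Complementing reverses membership: `f x` is outside `Φ Aˣ` and, by `fx∈ΦAʸ`, inside
            -- `Φ Aʸ`. This is why x and y trade places below.
            fx∉ΦAˣ : ∀ {A} → Φ Aˣ ≡ A → to x ∉ proj₁ A
            fx∉ΦAˣ ΦAˣ≡A = subst (to x ∉_)
              (cong proj₁ (trans (sym (φ≡𝔠∘ι Aˣ)) ΦAˣ≡A)) (x∈p⇒x∉∁p fx∈fAˣ)

            fx∈ΦAʸ : ∀ {A} → Φ Aʸ ≡ A → to x ∈ proj₁ A
            fx∈ΦAʸ ΦAʸ≡A = subst (to x ∈_)
              (cong proj₁ (trans (sym (φ≡𝔠∘ι Aʸ)) ΦAʸ≡A)) (x∉p⇒x∈∁p fx∉fAʸ)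

          𝔠∘ι-swapped⇒fx≡x : α t → to x ≡ x
          𝔠∘ι-swapped⇒fx≡x t∈α =
            let Φˣ , Φʸ = swapped t∈α in ∈Aˣ∖Aʸ (fx∈ΦAʸ Φʸ) (fx∉ΦAˣ Φˣ)

          𝔠∘ι-fixed⇒fx≡y : ¬ α t → to x ≡ y
          𝔠∘ι-fixed⇒fx≡y t∉α =
            let Φˣ , Φʸ = fixed t∉α in ∈Aʸ∖Aˣ (fx∈ΦAʸ Φʸ) (fx∉ΦAˣ Φˣ)

      φ≡ι⇒α-trivial : (∀ A → Φ A ≡ ι f A) → α ≐ ∅ ⊎ α ≐ T k cut comps
      φ≡ι⇒α-trivial φ≡ι = α-trivial (to x ≟ y)
        (λ t∈T → ι-swapped⇒fx≡y (twins t∈T) φ≡ι)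
        (λ t∈T t∉α fx≡y → x≢y (trans (sym (ι-fixed⇒fx≡x (twins t∈T) φ≡ι t∉α)) fx≡y))

      φ≡𝔠∘ι⇒α-trivial : (n≡2k : n ≡ 2 * k) → (∀ A → Φ A ≡ 𝔠 n≡2k (ι f A)) →
                        α ≐ ∅ ⊎ α ≐ T k cut comps
      -- The test is against `x` instead of `y`, as the complement interchanges the two cases.
      φ≡𝔠∘ι⇒α-trivial n≡2k φ≡𝔠∘ι = α-trivial (to x ≟ x)
        (λ t∈T → 𝔠∘ι-swapped⇒fx≡x (twins t∈T) n≡2k φ≡𝔠∘ι)
        (λ t∈T t∉α fx≡x →
          x≢y (trans (sym fx≡x) (𝔠∘ι-fixed⇒fx≡y (twins t∈T) n≡2k φ≡𝔠∘ι t∉α)))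

    -- Inducing automorphisms for the two extreme choices of α

    φ≡ι-id : α ≐ ∅ → ∀ A → Φ A ≡ ι {G = G} idAut A
    φ≡ι-id (α⊆∅ , _) A@(p , _) =
      trans (φ-fixes α⊆∅) (KSubset-≡ (sym (image-involutive (λ _ → refl) p p id id)))

    -- Token sets with one token on `S` have their profile in `T`, and there flipping is the action
    -- of the transposition; on all others both maps are the identity.
    φ≡ι-swap : α ≐ T k cut comps → ∀ A → Φ A ≡ ι (swapAut cut) A
    φ≡ι-swap (_ , T⊆α) A@(p , _) = by-cases (α? (prof A))
      where
      by-cases : Dec (α (prof A)) → Φ A ≡ ι (swapAut cut) A
      by-cases (yes A∈α) = KSubset-≡ (trans (φ-flips A∈α)
        (sym (image-swap-△ cut p (T-profile⁻ A (α⊆T A∈α)))))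
      by-cases (no A∉α) = trans (φ-fixes A∉α)
        (KSubset-≡ (sym (image-swap-fixed cut p (A∉α ∘ T⊆α ∘ T-profile⁺ A))))

proposition3 : ∀ {n} (G : Graph (Fin n)) → Connected G →
    (k : ℕ) → 1 ≤ k → k < n →
    (cut : TwinCut G) (comps : Components G (TwinCut.S cut)) →
    (α : Pred (Vec ℕ (Components.c comps)) 0ℓ) (α? : Decidable α) (α⊆T : α ⊆ T k cut comps) →
    Σ[ aut ∈ IsAutomorphism (tokenGraph k G) (φ k cut comps α? α⊆T) ]
    (Induced k G (mkAut (φ k cut comps α? α⊆T) aut) ⇔ (α ≐ ∅ ⊎ α ≐ T k cut comps))
proposition3 G _ k _ _ cut comps α α? α⊆T =
  φ-isAutomorphism k cut comps α? α⊆T , mk⇔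
    (λ { (f , inj₁ φ≡ι) → φ≡ι⇒α-trivial k cut comps α? α⊆T f φ≡ι
       ; (f , inj₂ (n≡2k , φ≡𝔠∘ι)) → φ≡𝔠∘ι⇒α-trivial k cut comps α? α⊆T f n≡2k φ≡𝔠∘ι })
    [ (λ α≐∅ → idAut , inj₁ (φ≡ι-id k cut comps α? α⊆T α≐∅))
    , (λ α≐T → swapAut cut , inj₁ (φ≡ι-swap k cut comps α? α⊆T α≐T)) ]′
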